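{- Let $N\ge1$ and $D\ge1$ be integers and let $\mathcal R=\mathbb R[t]/(t^D)$. Let $A\in\mathcal R^{N\times N}$ be symmetric with distinct eigenvalues (meaning that its constant coefficient $A_0\in\mathbb R^{N\times N}$ has $N$ distinct eigenvalues), and let $Q,\Lambda\in\mathcal R^{N\times N}$ be its eigenvalue decomposition, i.e. $$Q^TAQ=\Lambda,\qquad Q^TQ=I,\qquad \Lambda=\operatorname{diag}(\lambda_1,\dots,\lambda_N)\text{ diagonal}.$$ Given $A$, $Q$, $\Lambda$ and adjoints $\bar Q,\bar\Lambda\in\mathcal R^{N\times N}$ of $Q$ and $\Lambda$, the pullback of the symmetric eigenvalue decomposition $A\mapsto(Q,\Lambda)$ computes the adjoint $\bar A\in\mathcal R^{N\times N}$ of $A$ by $$H_{ij}=(\lambda_j-\lambda_i)^{ -1}\ \text{ if } i\neq j,\qquad H_{ij}=0\ \text{ else},$$ $$\bar A=Q\big(\bar\Lambda+H\circ(Q^T\bar Q)\big)Q^T ,$$ all operations being carried out in $\mathcal R$. That is, this $\bar A$ satisfies $$\operatorname{tr}(\bar A^T\mathrm dA)=\operatorname{tr}(\bar\Lambda^T\mathrm d\Lambda)+\operatorname{tr}(\bar Q^T\mathrm dQ)$$ for the differentials $\mathrm dA,\mathrm dQ,\mathrm d\Lambda$ of the eigenvalue decomposition.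
   Context: Matrices over $\mathcal R=\mathbb R[t]/(t^D)$ are identified with polynomials $\sum_{d=0}^{D-1}X_dt^d$ with real matrix coefficients, multiplied modulo $t^D$; the case $D=1$ is the ordinary real case. $\circ$ is the Hadamard (entrywise) product, $I$ the identity matrix. The pullback of a decomposition $A\mapsto(Q,\Lambda)$ is the map computing the adjoint $\bar A$ of the input from the adjoints $\bar Q,\bar\Lambda$ of the outputs (together with $A,Q,\Lambda$) such that $\operatorname{tr}(\bar A^T\mathrm dA)=\operatorname{tr}(\bar\Lambda^T\mathrm d\Lambda)+\operatorname{tr}(\bar Q^T\mathrm dQ)$. The differentials $\mathrm dA,\mathrm dQ,\mathrm d\Lambda$ (with $\mathrm dA$ symmetric, as $A$ is) are those obtained by differentiating the system $Q^TAQ-\Lambda=0$, $Q^TQ-I=0$, off-diagonal part of $\Lambda$ equal to $0$; that is, $\mathrm d\Lambda=\mathrm dQ^TAQ+Q^T\mathrm dA\,Q+Q^TA\,\mathrm dQ$, $\mathrm dQ^TQ+Q^T\mathrm dQ=0$, and $\mathrm d\Lambda$ diagonal.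
   Formalization: The adjoint Λ̄ is required to be diagonal; for arbitrary Λ̄ the claim fails, e.g. N=2, D=1, A=Λ=diag(0,1), Q=I, Q̄=0, Λ̄=dA=[[0,1],[1,0]], dQ=[[0,1],[-1,0]], dΛ=0 gives 2=0. -}

module Defs where

open import Level using (_⊔_) renaming (suc to lsuc)
open import Data.Nat.Base as ℕ using (ℕ; NonZero; >-nonZero⁻¹)
open import Data.Fin.Base using (Fin; zero; suc; toℕ; fromℕ<)
import Data.Nat.Properties as ℕₚ
import Data.Fin.Properties as Fin
open import Data.Bool.Base using (if_then_else_)
open import Data.Product.Base using (_×_; proj₁; ∃-syntax; Σ-syntax)
open import Data.Sum.Base using (_⊎_)
open import Data.Vec.Functional using (Vector; transpose)
open import Function.Bundles using (_⇔_)
open import Relation.Nullary using (yes; no; does)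
open import Relation.Binary.Core using (Rel)
open import Relation.Binary.Structures using (IsStrictPartialOrder)
open import Relation.Binary.PropositionalEquality.Core using (_≢_)
open import Algebra.Bundles using (RawRing; CommutativeRing)
open import Algebra.Apartness.Bundles using (HeytingField; HeytingCommutativeRing)
import Algebra.Definitions as AlgDefs
import Algebra.Definitions.RawMonoid as RawMonoidDefs

-- The real numbers, given axiomatically as a Cauchy-complete Archimedean
-- ordered field; classically there is exactly one up to isomorphism.
-- x # y is the constructive form of x ≠ y.
record Reals c ℓ₁ ℓ₂ ℓ₃ : Set (lsuc (c ⊔ ℓ₁ ⊔ ℓ₂ ⊔ ℓ₃)) where
  field
    heytingField : HeytingField c ℓ₁ ℓ₂

  open HeytingField heytingField public
  open RawMonoidDefs (CommutativeRing.+-rawMonoid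
    (HeytingCommutativeRing.commutativeRing heytingCommutativeRing)) public
    using () renaming (_×_ to _·_)

  infix 4 _<_
  field
    _<_                  : Rel Carrier ℓ₃
    isStrictPartialOrder : IsStrictPartialOrder _≈_ _<_
    #⇔<⊎>                : ∀ {x y} → x # y ⇔ (x < y ⊎ y < x)
    +-monoˡ-<            : ∀ {x y} z → x < y → x + z < y + z
    *-pos                : ∀ {x y} → 0# < x → 0# < y → 0# < x * y
    archimedean          : ∀ x → ∃[ n ] x < n · 1#

  -- |x - y| < ε
  Within : Carrier → Carrier → Carrier → Set ℓ₃
  Within ε x y = x - y < ε × y - x < ε

  IsCauchy : (ℕ → Carrier) → Set (c ⊔ ℓ₃)
  IsCauchy s = ∀ ε → 0# < ε →
    ∃[ k ] ∀ m n → k ℕ.≤ m → k ℕ.≤ n → Within ε (s m) (s n)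

  _ConvergesTo_ : (ℕ → Carrier) → Carrier → Set (c ⊔ ℓ₃)
  s ConvergesTo l = ∀ ε → 0# < ε → ∃[ k ] ∀ n → k ℕ.≤ n → Within ε (s n) l

  field
    complete : ∀ s → IsCauchy s → ∃[ l ] s ConvergesTo l

  rawRing : RawRing c ℓ₁
  rawRing = CommutativeRing.rawRing
    (HeytingCommutativeRing.commutativeRing heytingCommutativeRing)

-- R[t]/(t^D): x d is the coefficient of t^d.
module Truncated {c ℓ} (R : RawRing c ℓ) where

  open RawRing R
  open RawMonoidDefs +-rawMonoid using (sum)

  one : ∀ {D} → Vector Carrier D
  one zero    = 1#
  one (suc _) = 0#

  mul : ∀ {D} → Vector Carrier D → Vector Carrier D → Vector Carrier D
  mul x y d = sum λ i → sum λ j →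
    if does (toℕ i ℕ.+ toℕ j ℕₚ.≟ toℕ d) then x i * y j else 0#

  truncatedPolynomials : ℕ → RawRing c ℓ
  truncatedPolynomials D = record
    { Carrier = Vector Carrier D
    ; _≈_     = λ x y → ∀ d → x d ≈ y d
    ; _+_     = λ x y d → x d + y d
    ; _*_     = mul
    ; -_      = λ x d → - x d
    ; 0#      = λ _ → 0#
    ; 1#      = one
    }

  constantCoefficient : ∀ {D} .{{_ : NonZero D}} → Vector Carrier D → Carrier
  constantCoefficient {D} x = x (fromℕ< (>-nonZero⁻¹ D))

module Matrices {c ℓ} (R : RawRing c ℓ) where

  open RawRing R
  open RawMonoidDefs +-rawMonoid using (sum)

  Matrix : ℕ → Set c
  Matrix n = Vector (Vector Carrier n) n

  infix  4 _≈ᴹ_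
  infixl 6 _+ᴹ_
  infixl 7 _*ᴹ_ _∘ᴹ_ _*ⱽ_
  infixl 8 _ᵀ

  _≈ᴹ_ : ∀ {n} → Matrix n → Matrix n → Set ℓ
  X ≈ᴹ Y = ∀ i j → X i j ≈ Y i j

  _+ᴹ_ _*ᴹ_ : ∀ {n} → Matrix n → Matrix n → Matrix n
  (X +ᴹ Y) i j = X i j + Y i j
  (X *ᴹ Y) i j = sum λ k → X i k * Y k j

  _∘ᴹ_ : ∀ {n} → Matrix n → Matrix n → Matrix n
  (X ∘ᴹ Y) i j = X i j * Y i j

  _*ⱽ_ : ∀ {n} → Matrix n → Vector Carrier n → Vector Carrier n
  (X *ⱽ v) i = sum λ k → X i k * v k

  _ᵀ : ∀ {n} → Matrix n → Matrix n
  _ᵀ = transpose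

  tr : ∀ {n} → Matrix n → Carrier
  tr X = sum λ i → X i i

  0ᴹ : ∀ {n} → Matrix n
  0ᴹ _ _ = 0#

  diag : ∀ {n} → Vector Carrier n → Matrix n
  diag v i j = if does (i Fin.≟ j) then v i else 0#

  1ᴹ : ∀ {n} → Matrix n
  1ᴹ = diag λ _ → 1#

  IsSymmetric : ∀ {n} → Matrix n → Set ℓ
  IsSymmetric X = X ᵀ ≈ᴹ X

  IsDiagonal : ∀ {n} → Matrix n → Set ℓ
  IsDiagonal X = ∀ i j → i ≢ j → X i j ≈ 0#

module Eigenvalues {c ℓ₁ ℓ₂ ℓ₃} (ℝ : Reals c ℓ₁ ℓ₂ ℓ₃) where

  open Reals ℝ
  open Matrices rawRing using (Matrix; _*ⱽ_)

  IsEigenvalue : ∀ {n} → Matrix n → Carrier → Set (c ⊔ ℓ₁ ⊔ ℓ₂)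
  IsEigenvalue X μ = ∃[ v ]
    (∃[ i ] v i # 0#) × (∀ i → (X *ⱽ v) i ≈ μ * v i)

  HasDistinctEigenvalues : ∀ {n} → Matrix n → Set (c ⊔ ℓ₁ ⊔ ℓ₂)
  HasDistinctEigenvalues {n} X = Σ[ μ ∈ Vector Carrier n ]
    (∀ i j → i ≢ j → μ i # μ j) × (∀ i → IsEigenvalue X (μ i))

module EigenvalueDecomposition
  {c ℓ₁ ℓ₂ ℓ₃} (ℝ : Reals c ℓ₁ ℓ₂ ℓ₃) (D : ℕ) where

  open Truncated (Reals.rawRing ℝ)

  𝓡 : RawRing c ℓ₁
  𝓡 = truncatedPolynomials D

  open RawRing 𝓡 public using (Carrier; _≈_; _+_; _*_; -_; 0#; 1#)
  open Matrices 𝓡 public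
  open AlgDefs _≈_ using (Invertible)

  HasDistinctEigenvalues : ∀ {n} .{{_ : NonZero D}} →
    Matrix n → Set (c ⊔ ℓ₁ ⊔ ℓ₂)
  HasDistinctEigenvalues A =
    Eigenvalues.HasDistinctEigenvalues ℝ λ i j → constantCoefficient (A i j)

  record IsDecomposition {n} (A Q Λ : Matrix n) (ev : Vector Carrier n) :
         Set ℓ₁ where
    field
      diagonalises : Q ᵀ *ᴹ A *ᴹ Q ≈ᴹ Λ
      orthogonal   : Q ᵀ *ᴹ Q ≈ᴹ 1ᴹ
      diagonal     : Λ ≈ᴹ diag ev

  record IsDifferential {n} (A Q dA dQ dΛ : Matrix n) : Set ℓ₁ where
    field
      dA-symmetric  : IsSymmetric dA
      dΛ-equation   : dΛ ≈ᴹ dQ ᵀ *ᴹ A *ᴹ Q +ᴹ Q ᵀ *ᴹ dA *ᴹ Q +ᴹ Q ᵀ *ᴹ A *ᴹ dQ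
      dQ-equation   : dQ ᵀ *ᴹ Q +ᴹ Q ᵀ *ᴹ dQ ≈ᴹ 0ᴹ
      dΛ-diagonal   : IsDiagonal dΛ

  -- Λ̄ is meant to be diagonal, as the adjoint of the diagonal Λ: dΛ only sees
  -- the diagonal of Λ̄, whereas an off-diagonal part of Λ̄ that is not
  -- antisymmetric would contribute to the left-hand side below when
  -- Ā = Q (Λ̄ + H ∘ (Qᵀ Q̄)) Qᵀ.
  IsPullback : ∀ {n} (A Q Q̄ Λ̄ Ā : Matrix n) → Set (c ⊔ ℓ₁)
  IsPullback A Q Q̄ Λ̄ Ā = ∀ dA dQ dΛ → IsDifferential A Q dA dQ dΛ →
    tr (Ā ᵀ *ᴹ dA) ≈ tr (Λ̄ ᵀ *ᴹ dΛ) + tr (Q̄ ᵀ *ᴹ dQ)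

  InvertibleDifferences : ∀ {n} → Vector Carrier n → Set (c ⊔ ℓ₁)
  InvertibleDifferences {n} ev =
    ∀ (i j : Fin n) → i ≢ j → Invertible 1# _*_ (ev j + - ev i)

  -- The inverses are unique, so H does not depend on the choice of inv.
  H : ∀ {n} (ev : Vector Carrier n) → InvertibleDifferences ev → Matrix n
  H ev inv i j with i Fin.≟ j
  ... | yes _  = 0#
  ... | no i≢j = proj₁ (inv i j i≢j)

{-# OPTIONS --safe #-}

-- With C = Qᵀ dQ, which is antisymmetric, the relations A Q = Q Λ and
-- Qᵀ A = Λ Qᵀ turn the differentiated system into
-- (Qᵀ dA Q)ᵢⱼ = dΛᵢⱼ + Cᵢⱼ (λⱼ - λᵢ). Pairing this with Λ̄ + H ∘ (Qᵀ Q̄) entry by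
-- entry gives Λ̄ᵢⱼ dΛᵢⱼ + (Qᵀ Q̄)ᵢⱼ Cᵢⱼ.
-- Q Qᵀ = I holds because P = I - Q Qᵀ is a symmetric idempotent of trace 0: the
-- squares of its constant coefficients sum to 0, so t divides P, and P = P² then
-- makes every power of t divide P.
-- The λⱼ - λᵢ are invertible because each eigenvalue of A₀ is the constant
-- coefficient of some λₖ, hence by pigeonhole these coefficients are distinct.

module Submission where

open import Defs
open import Algebra.Apartness.Bundles using (HeytingCommutativeRing)
import Algebra.Apartness.Properties.HeytingCommutativeRing as HeytingProperties
open import Algebra.Bundles using (CommutativeRing; Ring)
import Algebra.Construct.Pointwise as Pointwise
import Algebra.Definitions as AlgebraDefinitions
open import Data.Bool.Base using (true; false; if_then_else_)
open import Data.Fin.Base using (Fin; zero; suc; toℕ; fromℕ<)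
import Data.Fin.Properties as Fin
open import Data.Nat.Base as ℕ using (ℕ; zero; suc; NonZero; s≤s)
import Data.Nat.Properties as ℕ
open import Data.Product.Base using (_,_; proj₁; proj₂; ∃-syntax; Σ-syntax)
open import Data.Sum.Base using (_⊎_; inj₁; inj₂; [_,_]′)
open import Data.Vec.Functional using (Vector; _∷_)
open import Function.Base using (_∘_)
open import Function.Bundles using (Equivalence)
open import Function.Definitions using (Injective)
open import Relation.Binary.PropositionalEquality as ≡ using (_≡_; _≢_)
open import Relation.Binary.Structures using (IsStrictPartialOrder)
open import Relation.Nullary using (¬_; yes; no; contradiction; does)
open import Relation.Nullary.Decidable using (dec-true; dec-false)

-- Finite sums over a commutative ring

module SumProperties {c ℓ} (R : CommutativeRing c ℓ) where

  open CommutativeRing R hiding (zero)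
  open import Algebra.Properties.Semiring.Sum semiring public
  open import Relation.Binary.Reasoning.Setoid setoid

  sum-zero : ∀ {n} {f : Vector Carrier n} → (∀ i → f i ≈ 0#) → sum f ≈ 0#
  sum-zero {n} f≈0 = trans (sum-cong-≋ f≈0) (sum-replicate-zero n)

  sum-single : ∀ {n} (f : Vector Carrier n) (j : Fin n) →
               (∀ i → i ≢ j → f i ≈ 0#) → sum f ≈ f j
  sum-single f zero    f≈0 =
    trans (+-congˡ (sum-zero λ i → f≈0 (suc i) λ ())) (+-identityʳ _)
  sum-single f (suc j) f≈0 =
    trans (+-congʳ (f≈0 zero λ ()))
      (trans (+-identityˡ _)
        (sum-single (f ∘ suc) j λ i i≢j → f≈0 (suc i) (i≢j ∘ Fin.suc-injective)))

  -- Stated for vectors and a rectangular `Y`, so that it serves both for associativity of `_*ᴹ_`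
  -- and for matrices acting on vectors.
  sum-assoc : ∀ {m n} (x : Vector Carrier m) (Y : Fin m → Vector Carrier n)
              (z : Vector Carrier n) →
              sum (λ k → sum (λ l → x l * Y l k) * z k) ≈
              sum (λ l → x l * sum (λ k → Y l k * z k))
  sum-assoc x Y z = begin
    sum (λ k → sum (λ l → x l * Y l k) * z k)
      ≈⟨ sum-cong-≋ (λ k → *-distribʳ-sum (z k) (λ l → x l * Y l k)) ⟩
    sum (λ k → sum (λ l → x l * Y l k * z k))
      ≈⟨ ∑-comm (λ k l → x l * Y l k * z k) ⟩
    sum (λ l → sum (λ k → x l * Y l k * z k))
      ≈⟨ sum-cong-≋ (λ l → sum-cong-≋ λ k → *-assoc (x l) (Y l k) (z k)) ⟩
    sum (λ l → sum (λ k → x l * (Y l k * z k)))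
      ≈⟨ sum-cong-≋ (λ l → *-distribˡ-sum (x l) (λ k → Y l k * z k)) ⟨
    sum (λ l → x l * sum (λ k → Y l k * z k)) ∎

-- Ring of square matrices, transpose and trace

module MatrixProperties {c ℓ} (R : CommutativeRing c ℓ) where

  open CommutativeRing R hiding (zero)
  open Matrices rawRing
  open SumProperties R

  diag-≡ : ∀ {n} (v : Vector Carrier n) i → diag v i i ≡ v i
  diag-≡ v i with i Fin.≟ i
  ... | yes _  = ≡.refl
  ... | no i≢i = contradiction ≡.refl i≢i

  diag-≢ : ∀ {n} (v : Vector Carrier n) → ∀ i j → i ≢ j → diag v i j ≡ 0#
  diag-≢ v i j i≢j with i Fin.≟ j
  ... | yes i≡j = contradiction i≡j i≢j
  ... | no _    = ≡.refl

  diag-* : ∀ {n} (v : Vector Carrier n) X i j →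
           (diag v *ᴹ X) i j ≈ v i * X i j
  diag-* v X i j = trans
    (sum-single (λ k → diag v i k * X k j) i λ k k≢i →
      trans (*-congʳ (reflexive (diag-≢ v i k (≡.≢-sym k≢i)))) (zeroˡ _))
    (*-congʳ (reflexive (diag-≡ v i)))

  *-diag : ∀ {n} (v : Vector Carrier n) X i j →
           (X *ᴹ diag v) i j ≈ X i j * v j
  *-diag v X i j = trans
    (sum-single (λ k → X i k * diag v k j) j λ k k≢j →
      trans (*-congˡ (reflexive (diag-≢ v k j k≢j))) (zeroʳ _))
    (*-congˡ (reflexive (diag-≡ v j)))

  ᵀ-*ᴹ : ∀ {n} (X Y : Matrix n) → (X *ᴹ Y) ᵀ ≈ᴹ Y ᵀ *ᴹ X ᵀ
  ᵀ-*ᴹ {n} X Y i j = sum-cong-≋ {n} λ k → *-comm (X j k) (Y k i)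

  1ᴹ-symmetric : ∀ {n} → IsSymmetric {n} 1ᴹ
  1ᴹ-symmetric i j with i Fin.≟ j
  ... | yes ≡.refl = reflexive (diag-≡ (λ _ → 1#) i)
  ... | no i≢j     = reflexive (diag-≢ (λ _ → 1#) j i (≡.≢-sym i≢j))

  tr-cong : ∀ {n} {X Y : Matrix n} → X ≈ᴹ Y → tr X ≈ tr Y
  tr-cong X≈Y = sum-cong-≋ λ i → X≈Y i i

  tr-comm : ∀ {n} (X Y : Matrix n) → tr (X *ᴹ Y) ≈ tr (Y *ᴹ X)
  tr-comm X Y = trans (∑-comm λ i k → X i k * Y k i)
    (sum-cong-≋ λ k → sum-cong-≋ λ i → *-comm (X i k) (Y k i))

  matrixRing : ℕ → Ring c ℓ
  matrixRing n = record
    { Carrier = Matrix n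
    ; _≈_     = _≈ᴹ_
    ; _+_     = _+ᴹ_
    ; _*_     = _*ᴹ_
    ; -_      = λ X i j → - X i j
    ; 0#      = 0ᴹ
    ; 1#      = 1ᴹ
    ; isRing  = record
      { +-isAbelianGroup =
          Pointwise.isAbelianGroup _ (Pointwise.isAbelianGroup _ +-isAbelianGroup)
      ; *-cong     = λ X≈X′ Y≈Y′ i j → sum-cong-≋ λ k → *-cong (X≈X′ i k) (Y≈Y′ k j)
      ; *-assoc    = λ X Y Z i j → sum-assoc (X i) Y λ k → Z k j
      ; *-identity = (λ X i j → trans (diag-* _ X i j) (*-identityˡ _))
                   , (λ X i j → trans (*-diag _ X i j) (*-identityʳ _))
      ; distrib    =
          (λ X Y Z i j → trans (sum-cong-≋ {n} λ k → distribˡ (X i k) (Y k j) (Z k j))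
                               (∑-distrib-+ (λ k → X i k * Y k j) _))
        , (λ X Y Z i j → trans (sum-cong-≋ {n} λ k → distribʳ (X k j) (Y i k) (Z i k))
                               (∑-distrib-+ (λ k → Y i k * X k j) _))
      }
    }

  module 𝕄 {n} = Ring (matrixRing n)

-- The pullback identity over a commutative ring

module EigendecompositionProperties {c ℓ} (R : CommutativeRing c ℓ) where

  open CommutativeRing R hiding (zero)
  open Matrices rawRing
  open MatrixProperties R
  open 𝕄 using () renaming
    ( setoid to ≈ᴹ-setoid; *-congˡ to *ᴹ-congˡ; *-congʳ to *ᴹ-congʳ
    ; *-assoc to *ᴹ-assoc; *-identityˡ to *ᴹ-identityˡ
    ; *-identityʳ to *ᴹ-identityʳ)
  open SumProperties R
  open import Algebra.Properties.Ring ring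
  open import Algebra.Properties.CommutativeSemigroup +-commutativeSemigroup
    using (x∙yz≈zx∙y)
  open import Algebra.Properties.CommutativeSemigroup *-commutativeSemigroup
    using () renaming (interchange to *-interchange)

  module _ {n} (A Q Λ : Matrix n)
    (QQᵀ≈1 : Q *ᴹ Q ᵀ ≈ᴹ 1ᴹ) (QᵀAQ≈Λ : Q ᵀ *ᴹ A *ᴹ Q ≈ᴹ Λ) where

    open import Relation.Binary.Reasoning.Setoid (≈ᴹ-setoid {n})

    -- Inserting Q Qᵀ in front of A Q produces Q (Qᵀ A Q). The order `Q *ᴹ Q ᵀ` is essential here;
    -- the decomposition only supplies `Q ᵀ *ᴹ Q`, hence the separate argument for it further on.
    AQ≈QΛ : A *ᴹ Q ≈ᴹ Q *ᴹ Λ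
    AQ≈QΛ = begin
      A *ᴹ Q                     ≈⟨ *ᴹ-identityˡ (A *ᴹ Q) ⟨
      1ᴹ *ᴹ (A *ᴹ Q)             ≈⟨ *ᴹ-congʳ {x = A *ᴹ Q} QQᵀ≈1 ⟨
      Q *ᴹ Q ᵀ *ᴹ (A *ᴹ Q)       ≈⟨ *ᴹ-assoc Q (Q ᵀ) (A *ᴹ Q) ⟩
      Q *ᴹ (Q ᵀ *ᴹ (A *ᴹ Q))     ≈⟨ *ᴹ-congˡ {x = Q} (*ᴹ-assoc (Q ᵀ) A Q) ⟨
      Q *ᴹ (Q ᵀ *ᴹ A *ᴹ Q)       ≈⟨ *ᴹ-congˡ {x = Q} QᵀAQ≈Λ ⟩
      Q *ᴹ Λ                     ∎

    QᵀA≈ΛQᵀ : Q ᵀ *ᴹ A ≈ᴹ Λ *ᴹ Q ᵀ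
    QᵀA≈ΛQᵀ = begin
      Q ᵀ *ᴹ A                   ≈⟨ *ᴹ-identityʳ (Q ᵀ *ᴹ A) ⟨
      Q ᵀ *ᴹ A *ᴹ 1ᴹ             ≈⟨ *ᴹ-congˡ {x = Q ᵀ *ᴹ A} QQᵀ≈1 ⟨
      Q ᵀ *ᴹ A *ᴹ (Q *ᴹ Q ᵀ)     ≈⟨ *ᴹ-assoc (Q ᵀ *ᴹ A) Q (Q ᵀ) ⟨
      Q ᵀ *ᴹ A *ᴹ Q *ᴹ Q ᵀ       ≈⟨ *ᴹ-congʳ {x = Q ᵀ} QᵀAQ≈Λ ⟩
      Λ *ᴹ Q ᵀ                   ∎

  -- Cyclicity of the trace carries the leftmost `Q` of the transposed product to the right end. The
  -- pairing of Ā with dA thereby becomes a pairing with Qᵀ dA Q, in the eigenbasis.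
  tr-conjugate : ∀ {n} (Q M X : Matrix n) →
    tr ((Q *ᴹ M *ᴹ Q ᵀ) ᵀ *ᴹ X) ≈ tr (M ᵀ *ᴹ (Q ᵀ *ᴹ X *ᴹ Q))
  tr-conjugate Q M X = begin
    tr ((Q *ᴹ M *ᴹ Q ᵀ) ᵀ *ᴹ X)
      ≈⟨ tr-cong (*ᴹ-congʳ {x = X} (ᵀ-*ᴹ (Q *ᴹ M) (Q ᵀ))) ⟩
    tr (Q *ᴹ (Q *ᴹ M) ᵀ *ᴹ X)
      ≈⟨ tr-cong (*ᴹ-assoc Q ((Q *ᴹ M) ᵀ) X) ⟩
    tr (Q *ᴹ ((Q *ᴹ M) ᵀ *ᴹ X))
      ≈⟨ tr-comm Q ((Q *ᴹ M) ᵀ *ᴹ X) ⟩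
    tr ((Q *ᴹ M) ᵀ *ᴹ X *ᴹ Q)
      ≈⟨ tr-cong (*ᴹ-congʳ {x = Q} (*ᴹ-congʳ {x = X} (ᵀ-*ᴹ Q M))) ⟩
    tr (M ᵀ *ᴹ Q ᵀ *ᴹ X *ᴹ Q)
      ≈⟨ tr-cong (*ᴹ-congʳ {x = Q} (*ᴹ-assoc (M ᵀ) (Q ᵀ) X)) ⟩
    tr (M ᵀ *ᴹ (Q ᵀ *ᴹ X) *ᴹ Q)
      ≈⟨ tr-cong (*ᴹ-assoc (M ᵀ) (Q ᵀ *ᴹ X) Q) ⟩
    tr (M ᵀ *ᴹ (Q ᵀ *ᴹ X *ᴹ Q)) ∎
    where open import Relation.Binary.Reasoning.Setoid setoid

  -- Q Qᵀ cancels between the two factors: the Frobenius pairing is invariant under rotation.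
  tr-rotate : ∀ {n} (Q X Y : Matrix n) → Q *ᴹ Q ᵀ ≈ᴹ 1ᴹ →
    tr ((Q ᵀ *ᴹ X) ᵀ *ᴹ (Q ᵀ *ᴹ Y)) ≈ tr (X ᵀ *ᴹ Y)
  tr-rotate Q X Y QQᵀ≈1 = tr-cong (begin
    (Q ᵀ *ᴹ X) ᵀ *ᴹ (Q ᵀ *ᴹ Y)   ≈⟨ *ᴹ-congʳ {x = Q ᵀ *ᴹ Y} (ᵀ-*ᴹ (Q ᵀ) X) ⟩
    X ᵀ *ᴹ Q *ᴹ (Q ᵀ *ᴹ Y)       ≈⟨ *ᴹ-assoc (X ᵀ) Q (Q ᵀ *ᴹ Y) ⟩
    X ᵀ *ᴹ (Q *ᴹ (Q ᵀ *ᴹ Y))     ≈⟨ *ᴹ-congˡ {x = X ᵀ} (*ᴹ-assoc Q (Q ᵀ) Y) ⟨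
    X ᵀ *ᴹ (Q *ᴹ Q ᵀ *ᴹ Y)       ≈⟨ *ᴹ-congˡ {x = X ᵀ} (*ᴹ-congʳ {x = Y} QQᵀ≈1) ⟩
    X ᵀ *ᴹ (1ᴹ *ᴹ Y)             ≈⟨ *ᴹ-congˡ {x = X ᵀ} (*ᴹ-identityˡ Y) ⟩
    X ᵀ *ᴹ Y                     ∎)
    where open import Relation.Binary.Reasoning.Setoid ≈ᴹ-setoid

  module Pullback {n} {A Q dA dQ dΛ : Matrix n} {ev : Vector Carrier n}
    (x+x≈0⇒x≈0 : ∀ {x} → x + x ≈ 0# → x ≈ 0#)
    (QQᵀ≈1 : Q *ᴹ Q ᵀ ≈ᴹ 1ᴹ)
    (QᵀAQ≈Λ : Q ᵀ *ᴹ A *ᴹ Q ≈ᴹ diag ev)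
    (dΛ-equation : dΛ ≈ᴹ dQ ᵀ *ᴹ A *ᴹ Q +ᴹ Q ᵀ *ᴹ dA *ᴹ Q +ᴹ Q ᵀ *ᴹ A *ᴹ dQ)
    (dQ-equation : dQ ᵀ *ᴹ Q +ᴹ Q ᵀ *ᴹ dQ ≈ᴹ 0ᴹ)
    (dΛ-diagonal : IsDiagonal dΛ)
    where

    open import Relation.Binary.Reasoning.Setoid setoid

    private
      Λ = diag ev
      B = Q ᵀ *ᴹ dA *ᴹ Q
      C = Q ᵀ *ᴹ dQ

    -- dQᵀ Q is the transpose of `C`, kept in the form in which it arises from dQᵀ A Q = dQᵀ Q Λ.
    C-antisymmetric : ∀ i j → (dQ ᵀ *ᴹ Q) i j ≈ - C i j
    C-antisymmetric i j = +-inverseˡ-unique _ _ (dQ-equation i j)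

    -- Antisymmetry only yields 2 `C i i` = 0. A general commutative ring may have 2-torsion, so
    -- `x+x≈0⇒x≈0` is a parameter.
    C-zero-diagonal : ∀ i → C i i ≈ 0#
    C-zero-diagonal i = x+x≈0⇒x≈0 (trans (+-congʳ (ᵀ-*ᴹ (Q ᵀ) dQ i i))
                                        (dQ-equation i i))

    dQᵀAQ≈-CΛ : ∀ i j → (dQ ᵀ *ᴹ A *ᴹ Q) i j ≈ - (C i j * ev j)
    dQᵀAQ≈-CΛ i j = begin
      (dQ ᵀ *ᴹ A *ᴹ Q) i j     ≈⟨ *ᴹ-assoc (dQ ᵀ) A Q i j ⟩
      (dQ ᵀ *ᴹ (A *ᴹ Q)) i j   ≈⟨ *ᴹ-congˡ {x = dQ ᵀ} (AQ≈QΛ A Q Λ QQᵀ≈1 QᵀAQ≈Λ) i j ⟩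
      (dQ ᵀ *ᴹ (Q *ᴹ Λ)) i j   ≈⟨ *ᴹ-assoc (dQ ᵀ) Q Λ i j ⟨
      (dQ ᵀ *ᴹ Q *ᴹ Λ) i j     ≈⟨ *-diag ev (dQ ᵀ *ᴹ Q) i j ⟩
      (dQ ᵀ *ᴹ Q) i j * ev j   ≈⟨ *-congʳ (C-antisymmetric i j) ⟩
      - C i j * ev j           ≈⟨ -‿distribˡ-* (C i j) (ev j) ⟨
      - (C i j * ev j)         ∎

    QᵀAdQ≈ΛC : ∀ i j → (Q ᵀ *ᴹ A *ᴹ dQ) i j ≈ ev i * C i j
    QᵀAdQ≈ΛC i j = begin
      (Q ᵀ *ᴹ A *ᴹ dQ) i j     ≈⟨ *ᴹ-congʳ {x = dQ} (QᵀA≈ΛQᵀ A Q Λ QQᵀ≈1 QᵀAQ≈Λ) i j ⟩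
      (Λ *ᴹ Q ᵀ *ᴹ dQ) i j     ≈⟨ *ᴹ-assoc Λ (Q ᵀ) dQ i j ⟩
      (Λ *ᴹ C) i j             ≈⟨ diag-* ev C i j ⟩
      ev i * C i j             ∎

    -- In the eigenbasis the differentiated system reads dΛ = - C Λ + B + Λ C. Solving for `B`
    -- leaves the commutator C Λ - Λ C, which is entrywise `C` times an eigenvalue gap.
    QᵀdAQ≈ : ∀ i j → B i j ≈ dΛ i j + C i j * (ev j - ev i)
    QᵀdAQ≈ i j = begin
      B i j                            ≈⟨ +-identityʳ (B i j) ⟨
      -- Adding and subtracting `u - v` exposes `- u + B i j + v`, the right-hand side of the
      -- differentiated equation.
      B i j + 0#                       ≈⟨ +-congˡ (-‿inverseˡ (u - v)) ⟨
      B i j + (- (u - v) + (u - v))    ≈⟨ +-assoc (B i j) (- (u - v)) (u - v) ⟨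
      B i j + - (u - v) + (u - v)      ≈⟨ +-congʳ (+-congˡ (⁻¹-anti-homo‿- u v)) ⟩
      B i j + (v - u) + (u - v)        ≈⟨ +-congʳ (x∙yz≈zx∙y (B i j) v (- u)) ⟩
      - u + B i j + v + (u - v)        ≈⟨ +-congʳ dΛ≈ ⟨
      dΛ i j + (u - v)                 ≈⟨ +-congˡ (+-congˡ (-‿cong (*-comm (ev i) (C i j)))) ⟩
      dΛ i j + (C i j * ev j - C i j * ev i)
        ≈⟨ +-congˡ (x[y-z]≈xy-xz (C i j) (ev j) (ev i)) ⟨
      dΛ i j + C i j * (ev j - ev i)   ∎
      where
      u = C i j * ev j
      v = ev i * C i j
      dΛ≈ : dΛ i j ≈ - u + B i j + v
      dΛ≈ = trans (dΛ-equation i j)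
        (+-cong (+-congʳ (dQᵀAQ≈-CΛ i j)) (QᵀAdQ≈ΛC i j))

    module _ {H : Matrix n}
      (H-diagonal : ∀ i → H i i ≈ 0#)
      (H-inverse  : ∀ i j → i ≢ j → H i j * (ev j - ev i) ≈ 1#)
      (Q̄ Λ̄ : Matrix n) (Λ̄-diagonal : IsDiagonal Λ̄)
      where

      private
        G = Q ᵀ *ᴹ Q̄
        M = Λ̄ +ᴹ H ∘ᴹ G

      -- On the diagonal `H` and `C` vanish, leaving only the Λ̄ term. Off the diagonal Λ̄ and dΛ
      -- vanish, and `H i j` cancels the gap that multiplies `C i j` in `B i j`.
      entrywise-pullback : ∀ i j →
        M i j * B i j ≈ Λ̄ i j * dΛ i j + G i j * C i j
      entrywise-pullback i j with i Fin.≟ j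
      ... | yes ≡.refl = begin
        (Λ̄ i i + H i i * G i i) * B i i
          ≈⟨ *-cong (trans (+-congˡ (trans (*-congʳ (H-diagonal i)) (zeroˡ _)))
                           (+-identityʳ _))
                    (QᵀdAQ≈ i i) ⟩
        Λ̄ i i * (dΛ i i + C i i * (ev i - ev i))
          ≈⟨ *-congˡ (+-congˡ (trans (*-congʳ (C-zero-diagonal i)) (zeroˡ _))) ⟩
        Λ̄ i i * (dΛ i i + 0#)
          ≈⟨ *-congˡ (+-identityʳ (dΛ i i)) ⟩
        Λ̄ i i * dΛ i i
          ≈⟨ +-identityʳ _ ⟨
        Λ̄ i i * dΛ i i + 0#
          ≈⟨ +-congˡ (trans (*-congˡ (C-zero-diagonal i)) (zeroʳ _)) ⟨
        Λ̄ i i * dΛ i i + G i i * C i i ∎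
      ... | no i≢j = begin
        (Λ̄ i j + H i j * G i j) * B i j
          ≈⟨ *-cong (trans (+-congʳ (Λ̄-diagonal i j i≢j)) (+-identityˡ _))
                    (trans (QᵀdAQ≈ i j)
                      (trans (+-congʳ (dΛ-diagonal i j i≢j)) (+-identityˡ _))) ⟩
        H i j * G i j * (C i j * (ev j - ev i))
          ≈⟨ *-congˡ (*-comm (C i j) (ev j - ev i)) ⟩
        H i j * G i j * ((ev j - ev i) * C i j)
          ≈⟨ *-interchange (H i j) (G i j) (ev j - ev i) (C i j) ⟩
        H i j * (ev j - ev i) * (G i j * C i j)
          ≈⟨ trans (*-congʳ (H-inverse i j i≢j)) (*-identityˡ _) ⟩
        G i j * C i j
          ≈⟨ +-identityˡ _ ⟨
        0# + G i j * C i j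
          ≈⟨ +-congʳ (trans (*-congʳ (Λ̄-diagonal i j i≢j)) (zeroˡ _)) ⟨
        Λ̄ i j * dΛ i j + G i j * C i j ∎

      pullback : tr ((Q *ᴹ M *ᴹ Q ᵀ) ᵀ *ᴹ dA) ≈ tr (Λ̄ ᵀ *ᴹ dΛ) + tr (Q̄ ᵀ *ᴹ dQ)
      pullback = begin
        tr ((Q *ᴹ M *ᴹ Q ᵀ) ᵀ *ᴹ dA)
          ≈⟨ tr-conjugate Q M dA ⟩
        tr (M ᵀ *ᴹ B)
          -- The trace of Mᵀ B unfolds to a sum over columns `j`, then rows `i`, of `M i j * B i j`.
          ≈⟨ sum-cong-≋ {n} (λ j → sum-cong-≋ {n} λ i → entrywise-pullback i j) ⟩
        sum (λ j → sum λ i → Λ̄ i j * dΛ i j + G i j * C i j)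
          ≈⟨ sum-cong-≋ {n} (λ j → ∑-distrib-+ (λ i → Λ̄ i j * dΛ i j) λ i → G i j * C i j) ⟩
        sum (λ j → (Λ̄ ᵀ *ᴹ dΛ) j j + (G ᵀ *ᴹ C) j j)
          ≈⟨ ∑-distrib-+ (λ j → (Λ̄ ᵀ *ᴹ dΛ) j j) (λ j → (G ᵀ *ᴹ C) j j) ⟩
        tr (Λ̄ ᵀ *ᴹ dΛ) + tr (G ᵀ *ᴹ C)
          ≈⟨ +-congˡ (tr-rotate Q Q̄ dQ QQᵀ≈1) ⟩
        tr (Λ̄ ᵀ *ᴹ dΛ) + tr (Q̄ ᵀ *ᴹ dQ) ∎

-- The ring of truncated polynomials and orders of vanishing

module TruncatedProperties {c ℓ} (R : CommutativeRing c ℓ) where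

  open CommutativeRing R hiding (zero)
  open Truncated rawRing
  open SumProperties R
  open import Relation.Binary.Reasoning.Setoid setoid
  open import Algebra.Properties.CommutativeSemigroup *-commutativeSemigroup
    using (x∙yz≈y∙xz)

  -- Kronecker delta with values in `R`: it turns the test inside `mul` into a factor, to which the
  -- laws of finite sums apply.
  δ : ℕ → ℕ → Carrier
  δ m n = if does (m ℕ.≟ n) then 1# else 0#

  δ-≡ : ∀ {m n} → m ≡ n → δ m n ≈ 1#
  δ-≡ {m} {n} m≡n rewrite dec-true (m ℕ.≟ n) m≡n = refl

  δ-≢ : ∀ {m n} → m ≢ n → δ m n ≈ 0#
  δ-≢ {m} {n} m≢n rewrite dec-false (m ℕ.≟ n) m≢n = refl

  if-δ : ∀ m n x → (if does (m ℕ.≟ n) then x else 0#) ≈ δ m n * x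
  if-δ m n x with does (m ℕ.≟ n)
  ... | true  = sym (*-identityˡ x)
  ... | false = sym (zeroˡ x)

  module _ {D : ℕ} where

    private
      P : Set c
      P = Vector Carrier D

    -- Σₖ φ(k) (x y)ₖ for the untruncated product x y.
    pairing : (ℕ → Carrier) → P → P → Carrier
    pairing φ x y = sum λ i → sum λ j → φ (toℕ i ℕ.+ toℕ j) * (x i * y j)

    mul-pairing : ∀ x y d → mul x y d ≈ pairing (λ m → δ m (toℕ d)) x y
    mul-pairing x y d = sum-cong-≋ λ i → sum-cong-≋ λ j →
      if-δ (toℕ i ℕ.+ toℕ j) (toℕ d) (x i * y j)

    -- The sifting property of the delta. For m ≥ D no index `k` equals `m` and every term is 0,
    -- which is why `φ` has to vanish from `D` on.
    δ-sum : ∀ (φ : ℕ → Carrier) → (∀ m → D ℕ.≤ m → φ m ≈ 0#) → ∀ m →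
            sum (λ (k : Fin D) → φ (toℕ k) * δ m (toℕ k)) ≈ φ m
    δ-sum φ φ≈0 m with m ℕ.<? D
    ... | yes m<D = begin
      sum (λ (k : Fin D) → φ (toℕ k) * δ m (toℕ k))
        ≈⟨ sum-single (λ k → φ (toℕ k) * δ m (toℕ k)) (fromℕ< m<D) (λ k k≢m → trans
             (*-congˡ (δ-≢ λ m≡k → k≢m (Fin.toℕ-injective
               (≡.trans (≡.sym m≡k) (≡.sym (Fin.toℕ-fromℕ< m<D))))))
             (zeroʳ _)) ⟩
      φ (toℕ (fromℕ< m<D)) * δ m (toℕ (fromℕ< m<D))
        ≈⟨ *-cong (reflexive (≡.cong φ (Fin.toℕ-fromℕ< m<D)))
                  (δ-≡ (≡.sym (Fin.toℕ-fromℕ< m<D))) ⟩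
      φ m * 1#
        ≈⟨ *-identityʳ (φ m) ⟩
      φ m ∎
    ... | no m≮D = begin
      sum (λ (k : Fin D) → φ (toℕ k) * δ m (toℕ k))
        ≈⟨ sum-zero {D} (λ k → trans
             (*-congˡ (δ-≢ λ m≡k → m≮D (≡.subst (ℕ._< D) (≡.sym m≡k) (Fin.toℕ<n k))))
             (zeroʳ _)) ⟩
      0#   ≈⟨ φ≈0 m (ℕ.≮⇒≥ m≮D) ⟨
      φ m  ∎

    -- A weight that vanishes from `D` on does not see the terms discarded by truncation, so
    -- truncated coefficients can be traded for an untruncated double sum.
    sum-mul : ∀ φ → (∀ m → D ℕ.≤ m → φ m ≈ 0#) → ∀ x y →
              sum (λ k → φ (toℕ k) * mul x y k) ≈ pairing φ x y
    sum-mul φ φ≈0 x y = begin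
      sum (λ k → φ (toℕ k) * mul x y k)
        ≈⟨ sum-cong-≋ (λ k → trans (*-congˡ (mul-pairing x y k))
             (trans (*-distribˡ-sum (φ (toℕ k)) λ i → sum λ j → Δ i j k * (x i * y j))
               (sum-cong-≋ λ i → *-distribˡ-sum (φ (toℕ k)) λ j → Δ i j k * (x i * y j)))) ⟩
      sum (λ k → sum λ i → sum λ j → φ (toℕ k) * (Δ i j k * (x i * y j)))
        ≈⟨ ∑-comm (λ k i → sum λ j → φ (toℕ k) * (Δ i j k * (x i * y j))) ⟩
      sum (λ i → sum λ k → sum λ j → φ (toℕ k) * (Δ i j k * (x i * y j)))
        ≈⟨ sum-cong-≋ (λ i → ∑-comm λ k j → φ (toℕ k) * (Δ i j k * (x i * y j))) ⟩
      sum (λ i → sum λ j → sum λ k → φ (toℕ k) * (Δ i j k * (x i * y j)))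
        ≈⟨ sum-cong-≋ (λ i → sum-cong-≋ λ j → trans
             (sum-cong-≋ {D} λ k → sym (*-assoc (φ (toℕ k)) (Δ i j k) (x i * y j)))
             (trans (sym (*-distribʳ-sum (x i * y j) λ k → φ (toℕ k) * Δ i j k))
                    (*-congʳ (δ-sum φ φ≈0 (toℕ i ℕ.+ toℕ j))))) ⟩
      pairing φ x y ∎
      where
      Δ : Fin D → Fin D → Fin D → Carrier
      Δ i j k = δ (toℕ i ℕ.+ toℕ j) (toℕ k)

    mul-cong : ∀ {x x′ y y′ : P} → (∀ d → x d ≈ x′ d) → (∀ d → y d ≈ y′ d) →
               ∀ d → mul x y d ≈ mul x′ y′ d
    mul-cong {x} {x′} {y} {y′} x≈x′ y≈y′ d = begin
      mul x y d    ≈⟨ mul-pairing x y d ⟩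
      _            ≈⟨ sum-cong-≋ (λ i → sum-cong-≋ λ j → *-congˡ (*-cong (x≈x′ i) (y≈y′ j))) ⟩
      _            ≈⟨ mul-pairing x′ y′ d ⟨
      mul x′ y′ d  ∎

    mul-comm : ∀ (x y : P) d → mul x y d ≈ mul y x d
    mul-comm x y d = begin
      mul x y d  ≈⟨ mul-pairing x y d ⟩
      _          ≈⟨ ∑-comm (λ i j → δ (toℕ i ℕ.+ toℕ j) (toℕ d) * (x i * y j)) ⟩
      _          ≈⟨ sum-cong-≋ (λ j → sum-cong-≋ λ i → *-cong
                      (reflexive (≡.cong (λ m → δ m (toℕ d)) (ℕ.+-comm (toℕ i) (toℕ j))))
                      (*-comm (x i) (y j))) ⟩
      _          ≈⟨ mul-pairing y x d ⟨
      mul y x d  ∎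

    mul-distribˡ : ∀ (x y z : P) d →
                   mul x (λ e → y e + z e) d ≈ mul x y d + mul x z d
    mul-distribˡ x y z d = begin
      mul x (λ e → y e + z e) d
        ≈⟨ mul-pairing x (λ e → y e + z e) d ⟩
      sum (λ i → sum λ j → δᵈ i j * (x i * (y j + z j)))
        ≈⟨ sum-cong-≋ (λ i → sum-cong-≋ λ j →
             trans (*-congˡ (distribˡ (x i) (y j) (z j))) (distribˡ (δᵈ i j) _ _)) ⟩
      sum (λ i → sum λ j → δᵈ i j * (x i * y j) + δᵈ i j * (x i * z j))
        ≈⟨ sum-cong-≋ (λ i → ∑-distrib-+ (λ j → δᵈ i j * (x i * y j)) _) ⟩
      sum (λ i → (sum λ j → δᵈ i j * (x i * y j)) + sum λ j → δᵈ i j * (x i * z j))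
        ≈⟨ ∑-distrib-+ (λ i → sum λ j → δᵈ i j * (x i * y j)) _ ⟩
      pairing (λ m → δ m (toℕ d)) x y + pairing (λ m → δ m (toℕ d)) x z
        ≈⟨ +-cong (mul-pairing x y d) (mul-pairing x z d) ⟨
      mul x y d + mul x z d ∎
      where
      δᵈ : Fin D → Fin D → Carrier
      δᵈ i j = δ (toℕ i ℕ.+ toℕ j) (toℕ d)

    -- A form of the triple product in which bracketing shows only in the indices. The inner product
    -- is expanded by `sum-mul`, with the weight that tests i + m = d.
    mul-triple : ∀ (x y z : P) d → mul x (mul y z) d ≈
      sum λ i → sum λ j → sum λ k →
        δ (toℕ i ℕ.+ (toℕ j ℕ.+ toℕ k)) (toℕ d) * (x i * (y j * z k))
    mul-triple x y z d = begin
      mul x (mul y z) d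
        ≈⟨ mul-pairing x (mul y z) d ⟩
      sum (λ i → sum λ m → φ i (toℕ m) * (x i * mul y z m))
        ≈⟨ sum-cong-≋ (λ i → trans
             (sum-cong-≋ λ m → x∙yz≈y∙xz (φ i (toℕ m)) (x i) (mul y z m))
             (trans (sym (*-distribˡ-sum (x i) λ m → φ i (toℕ m) * mul y z m))
                    (*-congˡ (sum-mul (φ i) (φ≈0 i) y z)))) ⟩
      sum (λ i → x i * pairing (φ i) y z)
        ≈⟨ sum-cong-≋ (λ i → trans
             (*-distribˡ-sum (x i) λ j → sum λ k → φ i (toℕ j ℕ.+ toℕ k) * (y j * z k))
             (sum-cong-≋ λ j → trans (*-distribˡ-sum (x i) λ k → φ i (toℕ j ℕ.+ toℕ k) * (y j * z k))
               (sum-cong-≋ λ k → x∙yz≈y∙xz (x i) (φ i (toℕ j ℕ.+ toℕ k)) (y j * z k)))) ⟩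
      _ ∎
      where
      φ : Fin D → ℕ → Carrier
      φ i m = δ (toℕ i ℕ.+ m) (toℕ d)
      φ≈0 : ∀ i m → D ℕ.≤ m → φ i m ≈ 0#
      -- d < D ≤ m ≤ i + m, so the delta is 0.
      φ≈0 i m D≤m = δ-≢ (ℕ.>⇒≢ (ℕ.≤-trans (Fin.toℕ<n d)
        (ℕ.≤-trans D≤m (ℕ.m≤n+m m (toℕ i)))))

    -- Only right-nested products have been expanded, so commutativity first moves `z` to the front.
    -- What remains is to reorder three sums and re-bracket the exponents.
    mul-assoc : ∀ (x y z : P) d → mul (mul x y) z d ≈ mul x (mul y z) d
    mul-assoc x y z d = begin
      mul (mul x y) z d
        ≈⟨ mul-comm (mul x y) z d ⟩
      mul z (mul x y) d
        ≈⟨ mul-triple z x y d ⟩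
      sum (λ k → sum λ i → sum λ j → f (toℕ k ℕ.+ (toℕ i ℕ.+ toℕ j)) * (z k * (x i * y j)))
        ≈⟨ ∑-comm (λ k i → sum λ j → f (toℕ k ℕ.+ (toℕ i ℕ.+ toℕ j)) * (z k * (x i * y j))) ⟩
      sum (λ i → sum λ k → sum λ j → f (toℕ k ℕ.+ (toℕ i ℕ.+ toℕ j)) * (z k * (x i * y j)))
        ≈⟨ sum-cong-≋ (λ i → ∑-comm λ k j → f (toℕ k ℕ.+ (toℕ i ℕ.+ toℕ j)) * (z k * (x i * y j))) ⟩
      sum (λ i → sum λ j → sum λ k → f (toℕ k ℕ.+ (toℕ i ℕ.+ toℕ j)) * (z k * (x i * y j)))
        ≈⟨ sum-cong-≋ (λ i → sum-cong-≋ λ j → sum-cong-≋ λ k → *-cong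
             (reflexive (≡.cong f (≡.trans (ℕ.+-comm (toℕ k) _)
                                           (ℕ.+-assoc (toℕ i) (toℕ j) (toℕ k)))))
             (trans (*-comm _ _) (*-assoc (x i) (y j) (z k)))) ⟩
      sum (λ i → sum λ j → sum λ k → f (toℕ i ℕ.+ (toℕ j ℕ.+ toℕ k)) * (x i * (y j * z k)))
        ≈⟨ mul-triple x y z d ⟨
      mul x (mul y z) d ∎
      where
      f : ℕ → Carrier
      f m = δ m (toℕ d)

  mul-one : ∀ {D} (x : Vector Carrier D) d → mul one x d ≈ x d
  -- The index `d` excludes D = 0.
  mul-one {suc D} x d = begin
    mul one x d
      ≈⟨ mul-pairing one x d ⟩
    pairing (λ m → δ m (toℕ d)) one x
      ≈⟨ sum-single
           (λ (i : Fin (suc D)) → sum λ j → δ (toℕ i ℕ.+ toℕ j) (toℕ d) * (one i * x j))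
           zero (λ where
             zero    0≢0 → contradiction ≡.refl 0≢0
             (suc i) _   → sum-zero {suc D} λ j → trans (*-congˡ (zeroˡ (x j)))
               (zeroʳ (δ (suc (toℕ i ℕ.+ toℕ j)) (toℕ d)))) ⟩
    sum (λ j → δ (toℕ j) (toℕ d) * (1# * x j))
      ≈⟨ sum-single (λ j → δ (toℕ j) (toℕ d) * (1# * x j)) d (λ j j≢d → trans
           (*-congʳ (δ-≢ {toℕ j} {toℕ d} (j≢d ∘ Fin.toℕ-injective))) (zeroˡ _)) ⟩
    δ (toℕ d) (toℕ d) * (1# * x d)
      ≈⟨ trans (*-cong (δ-≡ {toℕ d} ≡.refl) (*-identityˡ (x d))) (*-identityˡ (x d)) ⟩
    x d ∎

  truncatedRing : ℕ → CommutativeRing c ℓ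
  truncatedRing D = record
    { isCommutativeRing = record
      { isRing = record
        { +-isAbelianGroup = Pointwise.isAbelianGroup (Fin D) +-isAbelianGroup
        ; *-cong     = mul-cong
        ; *-assoc    = mul-assoc
        ; *-identity = mul-one , λ x d → trans (mul-comm x one d) (mul-one x d)
        ; distrib    = mul-distribˡ , λ x y z d →
            trans (mul-comm _ x d) (trans (mul-distribˡ x y z d)
              (+-cong (mul-comm x y d) (mul-comm x z d)))
        }
      ; *-comm = mul-comm
      }
    }

  module 𝕋 (D : ℕ) = CommutativeRing (truncatedRing D)

  -- Divisibility by t^k; for k ≥ D it says that `x` is 0.
  VanishesBelow : ∀ {D} → ℕ → Vector Carrier D → Set ℓ
  VanishesBelow k x = ∀ i → toℕ i ℕ.< k → x i ≈ 0#

  vanishesBelow-1 : ∀ {D} {x : Vector Carrier (suc D)} → x zero ≈ 0# → VanishesBelow 1 x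
  vanishesBelow-1 x₀≈0 zero    _ = x₀≈0
  vanishesBelow-1 x₀≈0 (suc _) (s≤s ())

  m+n<o+p⇒m<o⊎n<p : ∀ {m n o p} → m ℕ.+ n ℕ.< o ℕ.+ p → m ℕ.< o ⊎ n ℕ.< p
  m+n<o+p⇒m<o⊎n<p {m} {n} {o} {p} m+n<o+p with m ℕ.<? o
  ... | yes m<o = inj₁ m<o
  ... | no m≮o  = inj₂ (ℕ.+-cancelˡ-< m n p
    (ℕ.<-≤-trans m+n<o+p (ℕ.+-monoˡ-≤ p (ℕ.≮⇒≥ m≮o))))

  -- A term `x i * y j` of coefficient `d` has i + j = d < k + l, so i < k or j < l, and one of its
  -- factors is 0.
  mul-vanishes : ∀ {D k l} {x y : Vector Carrier D} →
    VanishesBelow k x → VanishesBelow l y → VanishesBelow (k ℕ.+ l) (mul x y)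
  mul-vanishes {D} {k} {l} {x} {y} x≈0 y≈0 d d<k+l =
    trans (mul-pairing x y d) (sum-zero {D} λ i → sum-zero {D} λ j → term i j)
    where
    term : ∀ i j → δ (toℕ i ℕ.+ toℕ j) (toℕ d) * (x i * y j) ≈ 0#
    term i j with toℕ i ℕ.+ toℕ j ℕ.≟ toℕ d
    ... | no i+j≢d = trans (*-congʳ (δ-≢ i+j≢d)) (zeroˡ _)
    ... | yes i+j≡d with m+n<o+p⇒m<o⊎n<p (≡.subst (ℕ._< k ℕ.+ l) (≡.sym i+j≡d) d<k+l)
    ...   | inj₁ i<k = trans (*-congˡ (trans (*-congʳ (x≈0 i i<k)) (zeroˡ _))) (zeroʳ _)
    ...   | inj₂ j<l = trans (*-congˡ (trans (*-congˡ (y≈0 j j<l)) (zeroʳ _))) (zeroʳ _)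

  -- Only i = j = 0 contributes. Constant coefficients are thus multiplicative, which links the
  -- truncated ring to its base.
  mul-zero : ∀ {D} (x y : Vector Carrier (suc D)) → mul x y zero ≈ x zero * y zero
  mul-zero {D} x y = begin
    mul x y zero
      ≈⟨ mul-pairing x y zero ⟩
    pairing (λ m → δ m 0) x y
      ≈⟨ sum-single (λ i → sum λ j → δ (toℕ i ℕ.+ toℕ j) 0 * (x i * y j)) zero (λ where
           zero    0≢0 → contradiction ≡.refl 0≢0
           (suc i) _   → sum-zero {suc D} λ j → trans
             (*-congʳ (δ-≢ {suc (toℕ i ℕ.+ toℕ j)} {0} λ ()))
             (zeroˡ (x (suc i) * y j))) ⟩
    sum (λ j → δ (toℕ j) 0 * (x zero * y j))
      ≈⟨ sum-single (λ j → δ (toℕ j) 0 * (x zero * y j)) zero (λ where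
           zero    0≢0 → contradiction ≡.refl 0≢0
           (suc j) _   → trans (*-congʳ (δ-≢ {suc (toℕ j)} {0} λ ())) (zeroˡ _)) ⟩
    δ 0 0 * (x zero * y zero)
      ≈⟨ trans (*-congʳ (δ-≡ {0} ≡.refl)) (*-identityˡ _) ⟩
    x zero * y zero ∎

  sum-coefficient : ∀ {D n} (f : Vector (Vector Carrier D) n) d →
    SumProperties.sum (truncatedRing D) f d ≡ sum (λ i → f i d)
  sum-coefficient {n = zero}  f d = ≡.refl
  sum-coefficient {n = suc n} f d = ≡.cong (f zero d +_) (sum-coefficient (f ∘ suc) d)

-- Inverting truncated polynomials with invertible constant coefficient

module TruncatedInverse {c ℓ} (R : CommutativeRing c ℓ) where

  open TruncatedProperties R
  private module 𝕂 = CommutativeRing R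

  module _ {D : ℕ} where

    open 𝕋 (suc D) hiding (zero)
    open import Algebra.Properties.Ring ring
    open import Relation.Binary.Reasoning.Setoid setoid

    -- If n = 1 - x a vanishes at 0 and e = 1 - x y, then y + a e has error n e,
    -- which vanishes to one order more than e.
    approximateInverse : ∀ (x : Carrier) a → x zero 𝕂.* a 𝕂.≈ 𝕂.1# →
      ∀ k → ∃[ y ] VanishesBelow k (1# - x * y)
    approximateInverse x a x₀a≈1 zero    = 0# , λ _ ()
    approximateInverse x a x₀a≈1 (suc k) = y + ā * e , λ d d<k →
      𝕂.trans (error≈ d) (mul-vanishes {k = 1} {y = e} n-vanishes e-vanishes d d<k)
      where
      -- Every coefficient of `ā` is `a`, the constant one included; so `x * ā` has constant
      -- coefficient 1, as `n-vanishes` requires.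
      ā : Carrier
      ā _ = a
      y = proj₁ (approximateInverse x a x₀a≈1 k)
      e = 1# - x * y
      e-vanishes : VanishesBelow k e
      e-vanishes = proj₂ (approximateInverse x a x₀a≈1 k)
      n = 1# - x * ā
      n-vanishes : VanishesBelow 1 n
      n-vanishes = vanishesBelow-1 {x = n} (𝕂.trans
        (𝕂.+-congˡ (𝕂.-‿cong (𝕂.trans (mul-zero x ā) x₀a≈1))) (𝕂.-‿inverseʳ 𝕂.1#))
      error≈ : 1# - x * (y + ā * e) ≈ n * e
      error≈ = begin
        1# - x * (y + ā * e)          ≈⟨ +-congˡ {x = 1#} (-‿cong (distribˡ x y (ā * e))) ⟩
        1# - (x * y + x * (ā * e))    ≈⟨ +-congˡ {x = 1#} (-‿+-comm (x * y) (x * (ā * e))) ⟨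
        1# + (- (x * y) - x * (ā * e)) ≈⟨ +-assoc 1# (- (x * y)) (- (x * (ā * e))) ⟨
        e - x * (ā * e)               ≈⟨ +-cong (*-identityˡ e) (-‿cong (*-assoc x ā e)) ⟨
        1# * e - x * ā * e            ≈⟨ [y-z]x≈yx-zx e 1# (x * ā) ⟨
        n * e                         ∎

    invertible : ∀ (x : Carrier) a → x zero 𝕂.* a 𝕂.≈ 𝕂.1# →
      AlgebraDefinitions.Invertible _≈_ 1# _*_ x
    invertible x a x₀a≈1 = y , trans (*-comm y x) xy≈1 , xy≈1
      where
      -- The ring is truncated at `suc D`, so an error vanishing below `suc D` is 0.
      y = proj₁ (approximateInverse x a x₀a≈1 (suc D))
      xy≈1 : x * y ≈ 1#
      xy≈1 = sym (x∙y⁻¹≈ε⇒x≈y 1# (x * y) λ d →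
        proj₂ (approximateInverse x a x₀a≈1 (suc D)) d (Fin.toℕ<n d))

-- The projection I - Q Qᵀ

module Complement {c ℓ} (R : CommutativeRing c ℓ) where

  open CommutativeRing R hiding (zero)
  open Matrices rawRing
  open MatrixProperties R
  open SumProperties R
  open import Algebra.Properties.Ring ring

  module _ {n} (Q : Matrix n) (QᵀQ≈1 : Q ᵀ *ᴹ Q ≈ᴹ 1ᴹ) where

    private
      module M = Ring (matrixRing n)
    open import Algebra.Properties.Ring (matrixRing n) using ()
      renaming ([y-z]x≈yx-zx to [Y-Z]X≈YX-ZX; x[y-z]≈xy-xz to X[Y-Z]≈XY-XZ)

    complement : Matrix n
    complement = 1ᴹ M.- Q *ᴹ Q ᵀ

    Qᵀ-complement : Q ᵀ *ᴹ complement ≈ᴹ 0ᴹ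
    Qᵀ-complement = begin
      Q ᵀ *ᴹ complement                      ≈⟨ X[Y-Z]≈XY-XZ (Q ᵀ) 1ᴹ (Q *ᴹ Q ᵀ) ⟩
      Q ᵀ *ᴹ 1ᴹ M.- Q ᵀ *ᴹ (Q *ᴹ Q ᵀ)        ≈⟨ M.+-cong (M.*-identityʳ (Q ᵀ)) (M.-‿cong QᵀQQᵀ≈Qᵀ) ⟩
      Q ᵀ M.- Q ᵀ                            ≈⟨ M.-‿inverseʳ (Q ᵀ) ⟩
      0ᴹ ∎
      where
      open import Relation.Binary.Reasoning.Setoid M.setoid
      QᵀQQᵀ≈Qᵀ : Q ᵀ *ᴹ (Q *ᴹ Q ᵀ) ≈ᴹ Q ᵀ
      QᵀQQᵀ≈Qᵀ = begin
        Q ᵀ *ᴹ (Q *ᴹ Q ᵀ)   ≈⟨ M.*-assoc (Q ᵀ) Q (Q ᵀ) ⟨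
        Q ᵀ *ᴹ Q *ᴹ Q ᵀ     ≈⟨ M.*-congʳ {x = Q ᵀ} QᵀQ≈1 ⟩
        1ᴹ *ᴹ Q ᵀ           ≈⟨ M.*-identityˡ (Q ᵀ) ⟩
        Q ᵀ                 ∎

    -- P² = P - Q (Qᵀ P), and Qᵀ P = 0 because Qᵀ Q = I.
    complement-idempotent : complement *ᴹ complement ≈ᴹ complement
    complement-idempotent = begin
      complement *ᴹ complement
        ≈⟨ [Y-Z]X≈YX-ZX complement 1ᴹ (Q *ᴹ Q ᵀ) ⟩
      1ᴹ *ᴹ complement M.- Q *ᴹ Q ᵀ *ᴹ complement
        ≈⟨ M.+-cong (M.*-identityˡ complement) (M.-‿cong (begin
             Q *ᴹ Q ᵀ *ᴹ complement     ≈⟨ M.*-assoc Q (Q ᵀ) complement ⟩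
             Q *ᴹ (Q ᵀ *ᴹ complement)   ≈⟨ M.*-congˡ {x = Q} Qᵀ-complement ⟩
             Q *ᴹ 0ᴹ                    ≈⟨ M.zeroʳ Q ⟩
             0ᴹ                         ∎)) ⟩
      complement M.- 0ᴹ
        ≈⟨ (λ i j → trans (+-congˡ -0#≈0#) (+-identityʳ (complement i j))) ⟩
      complement ∎
      where open import Relation.Binary.Reasoning.Setoid M.setoid

    complement-symmetric : IsSymmetric complement
    complement-symmetric i j =
      +-cong (1ᴹ-symmetric {n} i j) (-‿cong (ᵀ-*ᴹ Q (Q ᵀ) i j))

    -- tr (Q Qᵀ) = tr (Qᵀ Q) = tr I, so P + Q Qᵀ = I leaves trace 0 for P. This is where `Q` being
    -- square enters.
    tr-complement : tr complement ≈ 0#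
    tr-complement = +-identityˡ-unique (tr complement) (tr {n} 1ᴹ) (begin
      tr complement + tr {n} 1ᴹ
        ≈⟨ +-congˡ (tr-cong QᵀQ≈1) ⟨
      tr complement + tr (Q ᵀ *ᴹ Q)
        ≈⟨ +-congˡ (tr-comm (Q ᵀ) Q) ⟩
      tr complement + tr (Q *ᴹ Q ᵀ)
        ≈⟨ ∑-distrib-+ (λ i → complement i i) (λ i → (Q *ᴹ Q ᵀ) i i) ⟨
      tr (complement +ᴹ Q *ᴹ Q ᵀ)
        ≈⟨ tr-cong {n} (λ i j → //-rightDividesˡ ((Q *ᴹ Q ᵀ) i j) (1ᴹ {n} i j)) ⟩
      tr {n} 1ᴹ ∎)
      where open import Relation.Binary.Reasoning.Setoid setoid

    -- By symmetry these squares are the summands of tr P², which equals tr P. Positivity can be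
    -- applied only after passing to constant coefficients.
    complement-squares : sum (λ i → sum λ j → complement i j * complement i j) ≈ 0#
    complement-squares = begin
      sum (λ i → sum λ j → complement i j * complement i j)
        ≈⟨ sum-cong-≋ {n} (λ i → sum-cong-≋ {n} λ j → *-congˡ (sym (complement-symmetric i j))) ⟩
      tr (complement *ᴹ complement)
        ≈⟨ tr-cong complement-idempotent ⟩
      tr complement
        ≈⟨ tr-complement ⟩
      0# ∎
      where open import Relation.Binary.Reasoning.Setoid setoid

-- Order and apartness on the reals

module RealProperties {c ℓ₁ ℓ₂ ℓ₃} (ℝ : Reals c ℓ₁ ℓ₂ ℓ₃) where

  open Reals ℝ hiding (zero)

  ℝ-ring : CommutativeRing c ℓ₁
  ℝ-ring = HeytingCommutativeRing.commutativeRing heytingCommutativeRing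

  open CommutativeRing ℝ-ring using (ring)
  open HeytingProperties heytingCommutativeRing
  open SumProperties ℝ-ring
  open import Algebra.Properties.Ring ring using (-‿distribˡ-*; -‿distribʳ-*; -‿involutive)
  open import Relation.Binary.Reasoning.Setoid setoid

  ¬#⇒≈ : ∀ {x y} → ¬ x # y → x ≈ y
  ¬#⇒≈ = proj₁ (tight _ _)

  private
    module < = IsStrictPartialOrder isStrictPartialOrder

  #0⇒<⊎> : ∀ {x} → x # 0# → x < 0# ⊎ 0# < x
  #0⇒<⊎> = Equivalence.to #⇔<⊎>

  <0⇒0<- : ∀ {x} → x < 0# → 0# < - x
  <0⇒0<- {x} x<0 = <.<-respˡ-≈ (-‿inverseʳ x)
    (<.<-respʳ-≈ (+-identityˡ (- x)) (+-monoˡ-< (- x) x<0))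

  +-pos : ∀ {x y} → 0# < x → 0# < y → 0# < x + y
  +-pos {x} {y} 0<x 0<y =
    <.trans 0<y (<.<-respˡ-≈ (+-identityˡ y) (+-monoˡ-< y 0<x))

  square-pos : ∀ {x} → x # 0# → 0# < x * x
  square-pos {x} x#0 with #0⇒<⊎> x#0
  ... | inj₂ 0<x = *-pos 0<x 0<x
  ... | inj₁ x<0 = <.<-respʳ-≈ (begin
    - x * - x      ≈⟨ -‿distribˡ-* x (- x) ⟨
    - (x * - x)    ≈⟨ -‿cong (-‿distribʳ-* x x) ⟨
    - - (x * x)    ≈⟨ -‿involutive (x * x) ⟩
    x * x          ∎) (*-pos (<0⇒0<- x<0) (<0⇒0<- x<0))

  square-zero : ∀ {x} → x * x ≈ 0# → x ≈ 0#
  square-zero x²≈0 = ¬#⇒≈ λ x#0 → <.irrefl (sym x²≈0) (square-pos x#0)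

  x+x≈0⇒x≈0 : ∀ {x} → x + x ≈ 0# → x ≈ 0#
  x+x≈0⇒x≈0 {x} x+x≈0 = ¬#⇒≈ λ x#0 → [ negative , positive ]′ (#0⇒<⊎> x#0)
    where
    positive : ¬ 0# < x
    positive 0<x = <.irrefl (sym x+x≈0) (+-pos 0<x 0<x)
    negative : ¬ x < 0#
    negative x<0 = <.irrefl x+x≈0
      (<.trans (<.<-respʳ-≈ (+-identityˡ x) (+-monoˡ-< x x<0)) x<0)

  -- Doubly negated, since the order is not decidable.
  NonNegative : Carrier → Set _
  NonNegative x = ¬ ¬ (x ≈ 0# ⊎ 0# < x)

  -- If the disjunction is refuted, then `x # 0#` is refuted as well, since it would make the square
  -- positive. Hence `x` is 0, and so is its square: a contradiction.
  square-nonNegative : ∀ x → NonNegative (x * x)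
  square-nonNegative x ¬0≤x² = ¬0≤x² (inj₁ (trans (*-congʳ x≈0) (zeroˡ x)))
    where
    x≈0 : x ≈ 0#
    x≈0 = ¬#⇒≈ λ x#0 → ¬0≤x² (inj₂ (square-pos x#0))

  pos+nonNegative : ∀ {x y} → 0# < x → NonNegative y → ¬ x + y ≈ 0#
  pos+nonNegative {x} {y} 0<x 0≤y x+y≈0 = 0≤y λ where
    (inj₁ y≈0) → <.irrefl
      (sym (trans (sym (+-identityʳ x)) (trans (+-congˡ (sym y≈0)) x+y≈0))) 0<x
    (inj₂ 0<y) → <.irrefl (sym x+y≈0) (+-pos 0<x 0<y)

  +-nonNegative : ∀ {x y} → NonNegative x → NonNegative y → NonNegative (x + y)
  +-nonNegative {x} {y} 0≤x 0≤y ¬0≤x+y = 0≤x λ where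
    (inj₁ x≈0) → 0≤y λ where
      (inj₁ y≈0) → ¬0≤x+y (inj₁ (trans (+-cong x≈0 y≈0) (+-identityˡ 0#)))
      (inj₂ 0<y) → ¬0≤x+y (inj₂ (<.<-respʳ-≈ (trans (sym (+-identityˡ y)) (+-congʳ (sym x≈0))) 0<y))
    (inj₂ 0<x) → 0≤y λ where
      (inj₁ y≈0) → ¬0≤x+y (inj₂ (<.<-respʳ-≈ (trans (sym (+-identityʳ x)) (+-congˡ (sym y≈0))) 0<x))
      (inj₂ 0<y) → ¬0≤x+y (inj₂ (+-pos 0<x 0<y))

  sum-nonNegative : ∀ {n} (f : Vector Carrier n) → (∀ i → NonNegative (f i)) →
                    NonNegative (sum f)
  sum-nonNegative {zero}  f 0≤f ¬0≤0 = ¬0≤0 (inj₁ refl)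
  sum-nonNegative {suc n} f 0≤f =
    +-nonNegative (0≤f zero) (sum-nonNegative (f ∘ suc) (0≤f ∘ suc))

  -- A head apart from 0 would be positive, and adding a nonnegative tail could not give 0. Once the
  -- head is 0 the tail sums to 0, and the argument recurs.
  sum-nonNegative-zero : ∀ {n} (f : Vector Carrier n) → (∀ i → NonNegative (f i)) →
                         sum f ≈ 0# → ∀ i → f i ≈ 0#
  sum-nonNegative-zero {suc n} f 0≤f Σf≈0 (suc i) =
    sum-nonNegative-zero (f ∘ suc) (0≤f ∘ suc)
      (trans (sym (+-identityˡ _))
        (trans (+-congʳ (sym (sum-nonNegative-zero f 0≤f Σf≈0 zero))) Σf≈0)) i
  sum-nonNegative-zero {suc n} f 0≤f Σf≈0 zero =
    ¬#⇒≈ λ f₀#0 → 0≤f zero λ where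
      (inj₁ f₀≈0) → #-irrefl f₀≈0 f₀#0
      (inj₂ 0<f₀) → pos+nonNegative 0<f₀
        (sum-nonNegative (f ∘ suc) (0≤f ∘ suc)) Σf≈0

  #⇒inverse : ∀ {x y} → x # y → ∃[ z ] (x - y) * z ≈ 1#
  #⇒inverse x#y with z , _ , [x-y]z≈1 ← #⇒invertible x#y = z , [x-y]z≈1

  #0⇒inverse : ∀ {x} → x # 0# → ∃[ y ] x * y ≈ 1#
  #0⇒inverse {x} x#0 with y , [x-0]y≈1 ← #⇒inverse x#0 =
    y , trans (*-congʳ (sym (x-0≈x x))) [x-0]y≈1

  -- If `z` inverts `x * y`, then `x * z` inverts `y`.
  *-#0 : ∀ {x y} → x * y # 0# → y # 0#
  *-#0 {x} {y} xy#0 with z , xyz≈1 ← #0⇒inverse xy#0 = invertibleʳ⇒# (x * z , (begin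
    (y - 0#) * (x * z)   ≈⟨ *-congʳ (x-0≈x y) ⟩
    y * (x * z)          ≈⟨ *-assoc y x z ⟨
    y * x * z            ≈⟨ *-congʳ (*-comm y x) ⟩
    x * y * z            ≈⟨ xyz≈1 ⟩
    1#                   ∎))

  -- Cotransitivity compares `y` with both sides of `x + y # 0#`. If `x + y # y`, the inverse of
  -- their difference also inverts `x`.
  +-#0 : ∀ {x y} → x + y # 0# → x # 0# ⊎ y # 0#
  +-#0 {x} {y} x+y#0 with #-cotrans x+y#0 y
  ... | inj₂ y#0   = inj₂ y#0
  ... | inj₁ x+y#y = inj₁ (invertible⇒# (z , trans (*-congˡ [x-0]≈) l , trans (*-congʳ [x-0]≈) r))
    where
    open import Algebra.Properties.Ring ring using (//-rightDividesʳ)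
    z = proj₁ (#⇒invertible x+y#y)
    l = proj₁ (proj₂ (#⇒invertible x+y#y))
    r = proj₂ (proj₂ (#⇒invertible x+y#y))
    [x-0]≈ : x - 0# ≈ x + y - y
    [x-0]≈ = trans (x-0≈x x) (sym (//-rightDividesʳ y x))

  sum-#0 : ∀ {n} (f : Vector Carrier n) → sum f # 0# → ∃[ i ] f i # 0#
  sum-#0 {zero}  f 0#0  = contradiction 0#0 (#-irrefl refl)
  sum-#0 {suc n} f Σf#0 with +-#0 Σf#0
  ... | inj₁ f₀#0 = zero , f₀#0
  ... | inj₂ Σ#0 with i , fᵢ#0 ← sum-#0 (f ∘ suc) Σ#0 = suc i , fᵢ#0

  *-cancelʳ-#0 : ∀ {x y z} → z # 0# → x * z ≈ y * z → x ≈ y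
  *-cancelʳ-#0 {x} {y} {z} z#0 xz≈yz with w , zw≈1 ← #0⇒inverse z#0 = begin
    x            ≈⟨ *-identityʳ x ⟨
    x * 1#       ≈⟨ *-congˡ zw≈1 ⟨
    x * (z * w)  ≈⟨ *-assoc x z w ⟨
    x * z * w    ≈⟨ *-congʳ xz≈yz ⟩
    y * z * w    ≈⟨ *-assoc y z w ⟩
    y * (z * w)  ≈⟨ *-congˡ zw≈1 ⟩
    y * 1#       ≈⟨ *-identityʳ y ⟩
    y            ∎

-- Distinct eigenvalues of a real matrix

injective⇒surjective : ∀ {n} {f : Fin n → Fin n} → Injective _≡_ _≡_ f →
                       ∀ j → ∃[ i ] f i ≡ j
injective⇒surjective {n} {f} f-injective j
  -- `j ∷ f` lists n + 1 elements of `Fin n`. A collision within `f` contradicts injectivity, so it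
  -- involves the head `j`.
  with Fin.pigeonhole (ℕ.n<1+n n) (j ∷ f)
... | zero  , suc i , _   , j≡fi  = i , ≡.sym j≡fi
... | suc i , suc k , i<k , fi≡fk =
  contradiction (≡.cong (toℕ ∘ suc) (f-injective fi≡fk)) (ℕ.<⇒≢ i<k)

module RealEigenvalues {c ℓ₁ ℓ₂ ℓ₃} (ℝ : Reals c ℓ₁ ℓ₂ ℓ₃) where

  open Reals ℝ hiding (zero)
  open RealProperties ℝ
  open Matrices rawRing
  open Eigenvalues ℝ
  open SumProperties ℝ-ring
  open MatrixProperties ℝ-ring
  open EigendecompositionProperties ℝ-ring
  open HeytingProperties heytingCommutativeRing using (#-congʳ; #-congˡ)
  open import Algebra.Properties.CommutativeSemigroup
    (CommutativeRing.*-commutativeSemigroup ℝ-ring) using (x∙yz≈y∙xz)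
  open import Relation.Binary.Reasoning.Setoid setoid

  module _ {n} (A Q : Matrix n) (ev : Vector Carrier n)
    (QQᵀ≈1 : Q *ᴹ Q ᵀ ≈ᴹ 1ᴹ) (QᵀAQ≈Λ : Q ᵀ *ᴹ A *ᴹ Q ≈ᴹ diag ev) where

    -- The coordinates w = Qᵀ v of an eigenvector satisfy λₖ wₖ = μ wₖ.
    eigenvalue-on-diagonal : ∀ {μ} → IsEigenvalue A μ → ∃[ k ] ev k ≈ μ
    eigenvalue-on-diagonal {μ} (v , (i , vᵢ#0) , Av≈μv) = k , *-cancelʳ-#0 wₖ#0 λw≈μw
      where
      w : Vector Carrier n
      w = Q ᵀ *ⱽ v
      v≈Qw : v i ≈ (Q *ⱽ w) i
      v≈Qw = begin
        v i
          ≈⟨ trans (*-congʳ (reflexive (diag-≡ _ i))) (*-identityˡ (v i)) ⟨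
        1ᴹ {n} i i * v i
          ≈⟨ sum-single (λ j → 1ᴹ i j * v j) i (λ j j≢i → trans
               (*-congʳ (reflexive (diag-≢ _ i j (≡.≢-sym j≢i)))) (zeroˡ (v j))) ⟨
        (1ᴹ *ⱽ v) i
          ≈⟨ sum-cong-≋ {n} (λ j → *-congʳ (QQᵀ≈1 i j)) ⟨
        (Q *ᴹ Q ᵀ *ⱽ v) i
          ≈⟨ sum-assoc (Q i) (Q ᵀ) v ⟩
        (Q *ⱽ w) i ∎
      -- `v i` is apart from 0 and equals this sum over `k`, so some term is apart from 0; its index
      -- is the witness.
      nonzeroTerm : ∃[ k ] Q i k * w k # 0#
      nonzeroTerm = sum-#0 (λ k → Q i k * w k) (#-congʳ v≈Qw vᵢ#0)
      k = proj₁ nonzeroTerm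
      wₖ#0 : w k # 0#
      wₖ#0 = *-#0 (proj₂ nonzeroTerm)
      λw≈μw : ev k * w k ≈ μ * w k
      λw≈μw = begin
        ev k * w k
          ≈⟨ *-distribˡ-sum (ev k) (λ j → Q j k * v j) ⟩
        sum (λ j → ev k * (Q j k * v j))
          ≈⟨ sum-cong-≋ {n} (λ j → trans (sym (*-assoc (ev k) (Q j k) (v j)))
               (*-congʳ (sym (trans (QᵀA≈ΛQᵀ A Q (diag ev) QQᵀ≈1 QᵀAQ≈Λ k j)
                                    (diag-* ev (Q ᵀ) k j))))) ⟩
        (Q ᵀ *ᴹ A *ⱽ v) k
          ≈⟨ sum-assoc ((Q ᵀ) k) A v ⟩
        sum (λ l → Q l k * (A *ⱽ v) l)
          ≈⟨ sum-cong-≋ {n} (λ l → trans (*-congˡ (Av≈μv l)) (x∙yz≈y∙xz (Q l k) μ (v l))) ⟩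
        sum (λ l → μ * (Q l k * v l))
          ≈⟨ *-distribˡ-sum μ (λ l → Q l k * v l) ⟨
        μ * w k ∎

    module _ (μ : Vector Carrier n) (μ-distinct : ∀ i j → i ≢ j → μ i # μ j)
      (μ-eigenvalue : ∀ i → IsEigenvalue A (μ i)) where

      position : Fin n → Fin n
      position i = proj₁ (eigenvalue-on-diagonal (μ-eigenvalue i))

      ev-position : ∀ i → ev (position i) ≈ μ i
      ev-position i = proj₂ (eigenvalue-on-diagonal (μ-eigenvalue i))

      position-injective : Injective _≡_ _≡_ position
      position-injective {i} {j} pᵢ≡pⱼ with i Fin.≟ j
      ... | yes i≡j = i≡j
      ... | no i≢j  = contradiction (μ-distinct i j i≢j) (#-irrefl (begin
        μ i               ≈⟨ ev-position i ⟨
        ev (position i)   ≡⟨ ≡.cong ev pᵢ≡pⱼ ⟩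
        ev (position j)   ≈⟨ ev-position j ⟩
        μ j               ∎))

      -- `position` is injective on a finite set, hence surjective: every diagonal entry equals some
      -- `μ i`, and different entries come from different `i`.
      diagonal-distinct : ∀ i j → i ≢ j → ev i # ev j
      diagonal-distinct i j i≢j
        with i′ , ≡.refl ← injective⇒surjective position-injective i
           | j′ , ≡.refl ← injective⇒surjective position-injective j =
        #-congʳ (sym (ev-position i′)) (#-congˡ (sym (ev-position j′))
          (μ-distinct i′ j′ (i≢j ∘ ≡.cong position)))

-- Reduction modulo t and the proof of Q Qᵀ = I

module TruncatedReals {c ℓ₁ ℓ₂ ℓ₃} (ℝ : Reals c ℓ₁ ℓ₂ ℓ₃) (D : ℕ) where

  open RealProperties ℝ
  private module ℝ = CommutativeRing ℝ-ring
  open TruncatedProperties ℝ-ring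
  open SumProperties ℝ-ring using (sum; sum-zero; sum-cong-≋)
  open CommutativeRing (truncatedRing (suc D)) hiding (zero)
  open Matrices rawRing
  open Matrices ℝ.rawRing using () renaming
    (Matrix to Matrix₀; _≈ᴹ_ to _≈ᴹ₀_; _*ᴹ_ to _*ᴹ₀_; diag to diag₀)
  open MatrixProperties (truncatedRing (suc D))
  open Complement (truncatedRing (suc D))
  open import Algebra.Properties.Ring ring using (x∙y⁻¹≈ε⇒x≈y)

  -- Reduction modulo t. At length `suc D`, `constantCoefficient` computes to the coefficient at
  -- `zero`, so the eigenvalue hypothesis on `A` is by definition one on `⌊ A ⌋`.
  ⌊_⌋ : ∀ {n} → Matrix n → Matrix₀ n
  ⌊ X ⌋ i j = X i j zero

  ⌊*ᴹ⌋ : ∀ {n} (X Y : Matrix n) → ⌊ X *ᴹ Y ⌋ ≈ᴹ₀ ⌊ X ⌋ *ᴹ₀ ⌊ Y ⌋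
  ⌊*ᴹ⌋ {n} X Y i j = ℝ.trans
    (ℝ.reflexive (sum-coefficient (λ k → X i k * Y k j) zero))
    (sum-cong-≋ {n} λ k → mul-zero (X i k) (Y k j))

  ⌊diag⌋ : ∀ {n} (v : Vector Carrier n) → ⌊ diag v ⌋ ≈ᴹ₀ diag₀ (λ i → v i zero)
  ⌊diag⌋ v i j with i Fin.≟ j
  ... | yes _ = ℝ.refl
  ... | no _  = ℝ.refl

  module _ {n} (Q : Matrix n) (QᵀQ≈1 : Q ᵀ *ᴹ Q ≈ᴹ 1ᴹ) where

    private
      P = complement Q QᵀQ≈1

    -- The squares of the entries of ⌊ P ⌋ sum to tr ⌊ P ⌋ = 0.
    complement-constant : ∀ i j → P i j zero ℝ.≈ ℝ.0#
    complement-constant i j = square-zero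
      (sum-nonNegative-zero (λ j → square i j) (λ j → square-nonNegative (P i j zero))
        (sum-nonNegative-zero (λ i → sum λ j → square i j)
          (λ i → sum-nonNegative (λ j → square i j) λ j → square-nonNegative (P i j zero))
          squares≈0 i) j)
      where
      square : Fin n → Fin n → ℝ.Carrier
      square i j = P i j zero ℝ.* P i j zero
      squares≈0 : sum (λ i → sum λ j → square i j) ℝ.≈ ℝ.0#
      squares≈0 = ℝ.trans (ℝ.sym (ℝ.trans
        (ℝ.reflexive (sum-coefficient (λ i → Σ𝕋.sum λ j → P i j * P i j) zero))
        (sum-cong-≋ {n} λ i → ℝ.trans
          (ℝ.reflexive (sum-coefficient (λ j → P i j * P i j) zero))
          (sum-cong-≋ {n} λ j → mul-zero (P i j) (P i j)))))
        (complement-squares Q QᵀQ≈1 zero)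
        where module Σ𝕋 = SumProperties (truncatedRing (suc D))

    -- P = P² gains an order of vanishing.
    complement-vanishes : ∀ k i j → VanishesBelow k (P i j)
    complement-vanishes zero          i j _ ()
    complement-vanishes (suc zero)    i j =
      vanishesBelow-1 {x = P i j} (complement-constant i j)
    complement-vanishes (suc (suc k)) i j d d<2+k = ℝ.trans
      (ℝ.sym (complement-idempotent Q QᵀQ≈1 i j d))
      (ℝ.trans (ℝ.reflexive (sum-coefficient (λ l → P i l * P l j) d))
        (sum-zero {n} λ l → mul-vanishes {k = 1} {x = P i l} {y = P l j}
          (vanishesBelow-1 {x = P i l} (complement-constant i l))
          (complement-vanishes (suc k) l j) d d<2+k))

    -- Vanishing below `suc D`, the length of the coefficient vectors, means that P is 0.
    QQᵀ≈1 : Q *ᴹ Q ᵀ ≈ᴹ 1ᴹ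
    QQᵀ≈1 i j = sym (x∙y⁻¹≈ε⇒x≈y (1ᴹ {n} i j) ((Q *ᴹ Q ᵀ) i j) λ d →
      complement-vanishes (suc D) i j d (Fin.toℕ<n d))

-- The matrix H and assembly of the pullback

module HProperties {c ℓ₁ ℓ₂ ℓ₃} (ℝ : Reals c ℓ₁ ℓ₂ ℓ₃) (D : ℕ) where

  open EigenvalueDecomposition ℝ D

  module _ {n} (ev : Vector Carrier n) (inv : InvertibleDifferences ev) where

    H-diagonal : ∀ i → H ev inv i i ≈ 0#
    H-diagonal i with i Fin.≟ i
    ... | yes _  = λ _ → Reals.refl ℝ
    ... | no i≢i = contradiction ≡.refl i≢i

    H-inverse : ∀ i j → i ≢ j → H ev inv i j * (ev j + - ev i) ≈ 1#
    H-inverse i j i≢j with i Fin.≟ j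
    ... | yes i≡j = contradiction i≡j i≢j
    -- `H` takes its inverse at the proof `i≢j′` returned by the test, so the left inverse law is
    -- read off there.
    ... | no i≢j′ = proj₁ (proj₂ (inv i j i≢j′))

mainTheorem4 : ∀ {c ℓ₁ ℓ₂ ℓ₃} (ℝ : Reals c ℓ₁ ℓ₂ ℓ₃)
    (N D : ℕ) .{{_ : NonZero N}} .{{_ : NonZero D}} →
    let open EigenvalueDecomposition ℝ D in
    (A Q Λ : Matrix N) (ev : Vector Carrier N) →
    IsSymmetric A →
    HasDistinctEigenvalues A →
    IsDecomposition A Q Λ ev →
    Σ[ inv ∈ InvertibleDifferences ev ]
    (∀ (Q̄ Λ̄ : Matrix N) → IsDiagonal Λ̄ →
    IsPullback A Q Q̄ Λ̄ (Q *ᴹ (Λ̄ +ᴹ H ev inv ∘ᴹ (Q ᵀ *ᴹ Q̄)) *ᴹ Q ᵀ))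
mainTheorem4 ℝ N (suc D) A Q Λ ev _ distinct decomposition = inv , pullback
  where
  open EigenvalueDecomposition ℝ (suc D)
  open IsDecomposition decomposition
  open HProperties ℝ (suc D)
  open RealProperties ℝ
  open TruncatedProperties ℝ-ring
  open TruncatedInverse ℝ-ring
  open TruncatedReals ℝ D
  open EigendecompositionProperties (truncatedRing (suc D))
  module ℝ = CommutativeRing ℝ-ring
  module 𝓡 = CommutativeRing (truncatedRing (suc D))

  QQᵀ : Q *ᴹ Q ᵀ ≈ᴹ 1ᴹ
  QQᵀ = QQᵀ≈1 Q orthogonal

  QᵀAQ≈Λ : Q ᵀ *ᴹ A *ᴹ Q ≈ᴹ diag ev
  QᵀAQ≈Λ i j = 𝓡.trans (diagonalises i j) (diagonal i j)

  -- Reducing Q Qᵀ = I and Qᵀ A Q = Λ modulo t gives a real eigendecomposition of `⌊ A ⌋`, to which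
  -- the result on real eigenvalues applies.
  ev₀-distinct : ∀ i j → i ≢ j → Reals._#_ ℝ (ev i zero) (ev j zero)
  ev₀-distinct = RealEigenvalues.diagonal-distinct ℝ ⌊ A ⌋ ⌊ Q ⌋ (λ i → ev i zero)
    (λ i j → ℝ.trans (ℝ.sym (⌊*ᴹ⌋ Q (Q ᵀ) i j))
      (ℝ.trans (QQᵀ i j zero) (⌊diag⌋ (λ _ → 1#) i j)))
    (λ i j → ℝ.trans
      (ℝ.sym (ℝ.trans (⌊*ᴹ⌋ (Q ᵀ *ᴹ A) Q i j)
        (SumProperties.sum-cong-≋ ℝ-ring {N} λ k → ℝ.*-congʳ (⌊*ᴹ⌋ (Q ᵀ) A i k))))
      (ℝ.trans (QᵀAQ≈Λ i j zero) (⌊diag⌋ ev i j)))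
    (proj₁ distinct) (proj₁ (proj₂ distinct)) (proj₂ (proj₂ distinct))

  inv : InvertibleDifferences ev
  inv i j i≢j = invertible (ev j + - ev i) (proj₁ δ₀⁻¹) (proj₂ δ₀⁻¹)
    -- The indices are swapped to match `ev j + - ev i`, whose constant coefficient is by definition
    -- the difference of the constant coefficients.
    where δ₀⁻¹ = #⇒inverse (ev₀-distinct j i (≡.≢-sym i≢j))

  pullback : (Q̄ Λ̄ : Matrix N) → IsDiagonal Λ̄ →
    IsPullback A Q Q̄ Λ̄ (Q *ᴹ (Λ̄ +ᴹ H ev inv ∘ᴹ (Q ᵀ *ᴹ Q̄)) *ᴹ Q ᵀ)
  pullback Q̄ Λ̄ Λ̄-diagonal dA dQ dΛ differential =
    Pullback.pullback {A = A} {Q} {dA} {dQ} {dΛ} {ev}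
      -- Addition is coefficientwise, so the absence of 2-torsion is inherited from the reals.
      (λ x+x≈0 d → x+x≈0⇒x≈0 (x+x≈0 d))
      QQᵀ QᵀAQ≈Λ
      (IsDifferential.dΛ-equation differential)
      (IsDifferential.dQ-equation differential)
      (IsDifferential.dΛ-diagonal differential)
      {H ev inv} (H-diagonal ev inv) (H-inverse ev inv) Q̄ Λ̄ Λ̄-diagonal
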